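{- Let $n$ be a non-negative integer and let $\alpha,\beta,\gamma$ be non-negative integers with $\alpha+\beta+\gamma=n+2$. Let $P_{n+2}^{\to}$ be a convex polygon with $n+2$ vertices together with a marked oriented boundary edge $\vec e$. For a triangulation $\tau$ of $P_{n+2}^{\to}$ (using only the vertices of the polygon), consider the unique colouring of the $n+2$ vertices by the three colours $\mathtt a,\mathtt b,\mathtt c$ such that the starting vertex of $\vec e$ has colour $\mathtt b$, the ending vertex of $\vec e$ has colour $\mathtt c$, and the three vertices of every triangle of $\tau$ have pairwise different colours. Then the number of triangulations of $P_{n+2}^{\to}$ for which this colouring has exactly $\alpha$ vertices of colour $\mathtt a$, $\beta$ vertices of colour $\mathtt b$ and $\gamma$ vertices of colour $\mathtt c$ equals $$\frac{\alpha(\alpha+\beta+\gamma-2)}{(\beta+\gamma-1)(\alpha+\gamma-1)(\alpha+\beta-1)}\binom{\beta+\gamma-1}{\alpha}\binom{\alpha+\gamma-1}{\beta-1}\binom{\alpha+\beta-1}{\gamma-1}.$$ In the case $\alpha=0$ this expression is to be interpreted as its limit as $\alpha\to0$, i.e. the number is $1$ if $(\alpha,\beta,\gamma)=(0,1,1)$ and $0$ otherwise.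
   Context: A convex polygon means one all of whose angles are less than 180 degrees; only the combinatorics matters, so for each $n$ one fixed polygon $P_{n+2}$ is considered, and $P_{n+2}^{\to}$ denotes it with a marked oriented boundary edge (the root edge). A triangulation of $P_{n+2}$ has exactly $n$ triangles. In the degenerate case $n=0$, the "polygon" $P_2^{\to}$ consists only of the marked oriented edge, and by convention there is exactly one triangulation (with no triangles), its two vertices coloured $\mathtt b$ (start) and $\mathtt c$ (end). For every triangulation the colouring described in the claim exists and is unique. -}

module Defs where

open import Data.Nat using (ℕ; zero; suc; _+_; _*_; _<_)
open import Data.Nat.Combinatorics using (_C_)
open import Data.Bool using (Bool; true; false; T; _∧_; not)
open import Data.List using (List; []; _∷_; _++_)
open import Data.List.Relation.Unary.All using (All)
open import Data.Vec using (Vec; []; _∷_)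
open import Data.Product using (Σ; _×_; _,_)
open import Relation.Binary.PropositionalEquality using (_≡_)

data Colour : Set where
  a b c : Colour

_==_ : Colour → Colour → Bool
a == a = true
b == b = true
c == c = true
_ == _ = false

-- The polygon P_{n+2} has vertices 0, 1, …, n+1 in cyclic (boundary) order.
-- The marked oriented root edge goes from vertex 0 (start) to vertex n+1 (end).
--
-- Tri i j : triangulations of the convex sub-polygon with vertices i, i+1, …, j
-- (base edge {i,j}).  Either the base edge is itself a boundary edge (j = i+1,
-- no triangles), or there is a unique triangle (i,k,j) on the base edge with
-- i < k < j, together with triangulations of the polygons on i..k and k..j.
data Tri : ℕ → ℕ → Set where
  edge  : ∀ i → Tri i (suc i)
  split : ∀ {i k j} → i < k → k < j → Tri i k → Tri k j → Tri i j

triangles : ∀ {i j} → Tri i j → List (ℕ × ℕ × ℕ)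
triangles (edge i) = []
triangles (split {i} {k} {j} _ _ l r) = (i , k , j) ∷ (triangles l ++ triangles r)

-- Colour of vertex k under a colouring given as a vector (default `a` out of
-- range; never used for vertices of the polygon).
col : ∀ {m} → Vec Colour m → ℕ → Colour
col [] _ = a
col (x ∷ v) zero = x
col (x ∷ v) (suc k) = col v k

Rainbow : Colour → Colour → Colour → Set
Rainbow x y z = T (not (x == y) ∧ not (y == z) ∧ not (x == z))

Proper : (n : ℕ) → Tri 0 (suc n) → Vec Colour (suc (suc n)) → Set
Proper n τ v =
  (col v 0 ≡ b) × (col v (suc n) ≡ c) ×
  All (λ { (x , y , z) → Rainbow (col v x) (col v y) (col v z) }) (triangles τ)

count : ∀ {m} → Colour → Vec Colour m → ℕ
count x [] = 0
count x (y ∷ v) with x == y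
... | true  = suc (count x v)
... | false = count x v

-- Triangulations of P_{n+2}^→ together with their (unique) colouring, whose
-- colouring has α vertices of colour a, β of colour b and γ of colour c.
Coloured : (n α β γ : ℕ) → Set
Coloured n α β γ =
  Σ (Tri 0 (suc n)) λ τ → Σ (Vec Colour (suc (suc n))) λ v →
    Proper n τ v × (count a v ≡ α) × (count b v ≡ β) × (count c v ≡ γ)

-- The value N of the formula (denominators cleared when α, β, γ ≥ 1).
Formula : (α β γ N : ℕ) → Set
Formula zero (suc zero) (suc zero) N = N ≡ 1
Formula zero _ _ N = N ≡ 0
-- α ≥ 1, β = 0 or γ = 0: a binomial coefficient with lower index -1 vanishes.
Formula (suc _) zero _ N = N ≡ 0
Formula (suc _) (suc _) zero N = N ≡ 0
-- α = a'+1, β = b'+1, γ = c'+1: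
--  N * (β+γ-1)(α+γ-1)(α+β-1)
--    = α(α+β+γ-2) * C(β+γ-1, α) * C(α+γ-1, β-1) * C(α+β-1, γ-1)
Formula (suc a') (suc b') (suc c') N =
  N * ((suc (b' + c')) * (suc (a' + c')) * (suc (a' + b')))
    ≡ suc a' * suc (a' + b' + c')
      * (suc (b' + c') C suc a') * (suc (a' + c') C b') * (suc (a' + b') C c')

{-# OPTIONS --safe #-}

-- Let m be the colour missing on an edge.  An edge is either on the boundary or
-- carries a triangle whose apex has colour m and whose other two edges miss the
-- other two colours.  Hence the generating functions X, Y, Z for a base edge
-- missing a, b, c (counting inner vertices only) satisfy
--   X = 1 + a Y Z,  Y = 1 + b Z X,  Z = 1 + c X Y.
-- Good's multivariate Lagrange inversion predicts the coefficient of aⁱ bʲ cᵏ in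
-- X^f Y^g Z^h: with p = f + j + k, q = g + i + k, r = h + i + j it is
--   [uⁱ vʲ wᵏ] (1 + u)^p (1 + v)^q (1 + w)^r Δ,
-- where Δ = 1 − st − sz − tz − 2stz with s = u/(1+u), t = v/(1+v), z = w/(1+w).
-- No inversion theorem is needed to verify it: splitting the first tree of a forest
-- turns the equations into a linear recursion, which for the prediction is
-- Pascal's rule in one of the three pairs (p , i), (q , j), (r , k); the empty
-- forest is settled by the absorption identity.
module Submission where

open import Defs
open import Data.Nat using (ℕ; _+_)
open import Data.Fin using (Fin)
open import Data.Product using (Σ; _×_)
open import Function.Bundles using (_↔_)
open import Relation.Binary.PropositionalEquality using (_≡_)
open import Axiom.UniquenessOfIdentityProofs.WithK using (uip)
open import Data.Bool using (Bool; true; false; not; if_then_else_)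
open import Data.Bool.Properties using (T-irrelevant)
open import Data.Empty using (⊥; ⊥-elim)
open import Data.Fin using (zero)
open import Data.Fin.Properties using (+↔⊎)
open import Data.List using (List; []; _∷_)
open import Data.List.Relation.Unary.All as All using (All; []; _∷_)
open import Data.List.Relation.Unary.All.Properties using (++⁺; ++⁻)
open import Data.Nat using (zero; suc; _*_; _≤_; _<_; _≤?_; z≤n; s≤s; z<s; NonZero)
open import Data.Nat.Combinatorics using (_C_; nCk+nC[k+1]≡[n+1]C[k+1]; k>n⇒nCk≡0)
open import Data.Nat.Properties using
  (+-comm; +-assoc; +-suc; +-identityʳ; *-comm; *-zeroʳ; *-distribʳ-+; *-distribˡ-+;
   *-cancelˡ-≡; +-cancelʳ-≡; m*n≢0; m+n≡0⇒m≡0; m+n≡0⇒n≡0; suc-injective; n<1+n; <-trans;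
   <-irrelevant; m≤n⇒m<n∨m≡n; ≤-antisym; ≤-pred; ≤-total; ≤-refl; ≤-trans; <⇒≤; n≮n;
   1+n≢0)
open import Data.Nat.Tactic.RingSolver using (solve-∀)
open import Data.Product using (∃; _,_; proj₁; proj₂)
open import Data.Sum using (_⊎_; inj₁; inj₂)
open import Data.Sum.Function.Propositional using (_⊎-↔_)
open import Data.Unit using (tt)
open import Data.Vec using (Vec; []; _∷_)
open import Function.Base using (_∘_)
open import Function.Bundles using (mk↔ₛ′)
open import Function.Construct.Composition using (_↔-∘_)
open import Function.Construct.Symmetry using (↔-sym)
open import Relation.Binary.PropositionalEquality using (refl; sym; trans; cong; cong₂; subst; subst₂; module ≡-Reasoning)
open import Relation.Nullary using (yes; no; contradiction)

-- Binomial coefficients: Pascal's rule and absorption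

-- The coefficient of uⁱ in u (1 + u)^(P ∸ 1), but 0 for P = 0.
D : ℕ → ℕ → ℕ
D P       zero    = 0
D zero    (suc i) = 0
D (suc P) (suc i) = P C i

C-pascal : ∀ n k → suc n C suc k ≡ n C suc k + n C k
C-pascal n k = trans (sym (nCk+nC[k+1]≡[n+1]C[k+1] n k)) (+-comm (n C k) (n C suc k))

D-pascal : ∀ P i → D (suc (suc P)) (suc i) ≡ D (suc P) (suc i) + D (suc P) i
D-pascal P zero    = refl
D-pascal P (suc i) = C-pascal P i

-- For positive arguments `D P i` is the binomial coefficient P - 1 over i - 1, so this is the
-- absorption identity. With the value 0 for `D zero` it also covers `P = 0`, where both sides
-- vanish.
absorb : ∀ P i → i * (P C i) ≡ P * D P i
absorb zero    zero    = refl
absorb zero    (suc i) = *-zeroʳ (suc i)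
absorb (suc P) zero    = sym (*-zeroʳ (suc P))
absorb (suc P) (suc i) = go P i
  where
  go : ∀ n k → suc k * (suc n C suc k) ≡ suc n * (n C k)
  go zero    zero    = refl
  go zero    (suc k) = trans (cong (suc (suc k) *_) (k>n⇒nCk≡0 (s≤s (s≤s (z≤n {k})))))  (*-zeroʳ (suc (suc k)))
  go (suc n) zero    = trans (cong (1 *_) (C-pascal (suc n) 0))
                         (trans (lem (suc n C 1)) (cong suc (go n zero)))
    where lem : ∀ x → 1 * (x + 1) ≡ suc (1 * x)
          lem = solve-∀
  go (suc n) (suc k) = begin
    suc (suc k) * (suc (suc n) C suc (suc k))            ≡⟨ cong (suc (suc k) *_) (C-pascal (suc n) (suc k)) ⟩
    suc (suc k) * (suc n C suc (suc k) + suc n C suc k)   ≡⟨ lem₁ k (suc n C suc (suc k)) (suc n C suc k) ⟩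
    suc (suc k) * (suc n C suc (suc k)) + suc k * (suc n C suc k) + suc n C suc k
      ≡⟨ cong₂ (λ x y → x + y + suc n C suc k) (go n (suc k)) (go n k) ⟩
    suc n * (n C suc k) + suc n * (n C k) + suc n C suc k ≡⟨ cong (λ x → suc n * (n C suc k) + suc n * (n C k) + x) (C-pascal n k) ⟩
    suc n * (n C suc k) + suc n * (n C k) + (n C suc k + n C k) ≡⟨ lem₂ n (n C suc k) (n C k) ⟩
    suc (suc n) * (n C suc k + n C k)                     ≡⟨ cong (suc (suc n) *_) (C-pascal n k) ⟨
    suc (suc n) * (suc n C suc k) ∎
    where
    open ≡-Reasoning
    lem₁ : ∀ k x y → suc (suc k) * (x + y) ≡ suc (suc k) * x + suc k * y + y
    lem₁ = solve-∀
    lem₂ : ∀ n x y → suc n * x + suc n * y + (x + y) ≡ suc (suc n) * (x + y)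
    lem₂ = solve-∀

-- The predicted coefficient and its Pascal rule

-- The coefficient of uⁱ vʲ wᵏ in (1 + u)^p (1 + v)^q (1 + w)^r (1 − Δ), on the other
-- side of the closed form so that no subtraction occurs.
correction : (c₁ d₁ c₂ d₂ c₃ d₃ : ℕ) → ℕ
correction c₁ d₁ c₂ d₂ c₃ d₃ = (d₁ * d₂) * (c₃ + 2 * d₃) + (d₁ * d₃) * c₂ + c₁ * (d₂ * d₃)

correction-swap₁₂ : ∀ c₁ d₁ c₂ d₂ c₃ d₃ → correction c₁ d₁ c₂ d₂ c₃ d₃ ≡ correction c₂ d₂ c₁ d₁ c₃ d₃
correction-swap₁₂ = ring
  where
  ring : ∀ c₁ d₁ c₂ d₂ c₃ d₃ →
    (d₁ * d₂) * (c₃ + 2 * d₃) + (d₁ * d₃) * c₂ + c₁ * (d₂ * d₃)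
    ≡ (d₂ * d₁) * (c₃ + 2 * d₃) + (d₂ * d₃) * c₁ + c₂ * (d₁ * d₃)
  ring = solve-∀

correction-swap₁₃ : ∀ c₁ d₁ c₂ d₂ c₃ d₃ → correction c₁ d₁ c₂ d₂ c₃ d₃ ≡ correction c₃ d₃ c₂ d₂ c₁ d₁
correction-swap₁₃ = ring
  where
  ring : ∀ c₁ d₁ c₂ d₂ c₃ d₃ →
    (d₁ * d₂) * (c₃ + 2 * d₃) + (d₁ * d₃) * c₂ + c₁ * (d₂ * d₃)
    ≡ (d₃ * d₂) * (c₁ + 2 * d₁) + (d₃ * d₁) * c₂ + c₃ * (d₂ * d₁)
  ring = solve-∀

-- The exponents `p`, `q`, `r` are independent of `i`, `j`, `k` here, so that Pascal's rule can act
-- on one pair while the other two stay fixed.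
record Closed (t p i q j r k : ℕ) : Set where
  constructor closedBy
  field
    formula : t + correction (p C i) (D p i) (q C j) (D q j) (r C k) (D r k) ≡ (p C i) * (q C j) * (r C k)

-- Δ is symmetric in s, t, z, so rules proved for the pair (p , i) carry over to the other two
-- pairs.
swap₁₂ : ∀ {t} p i q j r k → Closed t p i q j r k → Closed t q j p i r k
swap₁₂ {t} p i q j r k (closedBy h) = closedBy (
  trans (cong (t +_) (correction-swap₁₂ (q C j) (D q j) (p C i) (D p i) (r C k) (D r k)))
    (trans h (cong (_* (r C k)) (*-comm (p C i) (q C j)))))

swap₁₃ : ∀ {t} p i q j r k → Closed t p i q j r k → Closed t r k q j p i
swap₁₃ {t} p i q j r k (closedBy h) = closedBy (
  trans (cong (t +_) (correction-swap₁₃ (r C k) (D r k) (q C j) (D q j) (p C i) (D p i)))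
    (trans h (rev (p C i) (q C j) (r C k))))
  where
  rev : ∀ x y z → x * y * z ≡ z * y * x
  rev = solve-∀

-- The Pascal rule for D fails at p = 0; there the other factor vanishes.
D-pascal-* : ∀ p i q j → (p ≡ 0 → j ≡ 0) →
  D (suc p) (suc i) * D q j ≡ D p (suc i) * D q j + D p i * D q j
D-pascal-* zero i q j p⇒j rewrite p⇒j refl = trans (*-zeroʳ (D 1 (suc i)))
  (sym (*-zeroʳ (D 0 i)))
D-pascal-* (suc p) i q j _ = trans (cong (_* D q j) (D-pascal p i))
  (*-distribʳ-+ (D q j) (D (suc p) (suc i)) (D (suc p) i))

closed-zero : ∀ {t} p q j r k → Closed t p 0 q j r k → Closed t (suc p) 0 q j r k
closed-zero p q j r k (closedBy h) = closedBy h

-- Every term of the closed form is linear in the pair (`p C i`, `D p i`), so Pascal's rule lets two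
-- instances add up. The two implications handle `p = 0`, where `D q j` and `D r k` vanish.
closed-suc : ∀ {t₁ t₂} p i q j r k → (p ≡ 0 → j ≡ 0) → (p ≡ 0 → k ≡ 0) →
  Closed t₁ p (suc i) q j r k → Closed t₂ p i q j r k →
  Closed (t₁ + t₂) (suc p) (suc i) q j r k
closed-suc {t₁} {t₂} p i q j r k p⇒j p⇒k (closedBy h₁) (closedBy h₂) = closedBy (begin
  t₁ + t₂ + correction (suc p C suc i) d (q C j) (D q j) (r C k) (D r k)
    ≡⟨ cong (λ x → t₁ + t₂ + (d * D q j * (r C k + 2 * D r k) + d * D r k * (q C j) + x * (D q j * D r k))) (C-pascal p i) ⟩
  t₁ + t₂ + (d * D q j * (r C k + 2 * D r k) + d * D r k * (q C j) + (p C suc i + p C i) * (D q j * D r k))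
    ≡⟨ cong₂ (λ x y → t₁ + t₂ + (x * (r C k + 2 * D r k) + y * (q C j) + (p C suc i + p C i) * (D q j * D r k)))
         (D-pascal-* p i q j p⇒j) (D-pascal-* p i r k p⇒k) ⟩
  t₁ + t₂ + ((D p (suc i) * D q j + D p i * D q j) * (r C k + 2 * D r k) + (D p (suc i) * D r k + D p i * D r k) * (q C j)
     + (p C suc i + p C i) * (D q j * D r k))
    ≡⟨ ring₁ t₁ t₂ (p C suc i) (p C i) (D p (suc i)) (D p i) (q C j) (D q j) (r C k) (D r k) ⟩
  (t₁ + correction (p C suc i) (D p (suc i)) (q C j) (D q j) (r C k) (D r k)) + (t₂ + correction (p C i) (D p i) (q C j) (D q j) (r C k) (D r k))
    ≡⟨ cong₂ _+_ h₁ h₂ ⟩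
  (p C suc i) * (q C j) * (r C k) + (p C i) * (q C j) * (r C k)
    ≡⟨ ring₂ (p C suc i) (p C i) (q C j) (r C k) ⟩
  (p C suc i + p C i) * (q C j) * (r C k)
    ≡⟨ cong (λ x → x * (q C j) * (r C k)) (C-pascal p i) ⟨
  (suc p C suc i) * (q C j) * (r C k) ∎)
  where
  open ≡-Reasoning
  d = D (suc p) (suc i)
  ring₁ : ∀ t₁ t₂ x₁ x₂ y₁ y₂ u v w z →
    t₁ + t₂ + ((y₁ * v + y₂ * v) * (w + 2 * z) + (y₁ * z + y₂ * z) * u + (x₁ + x₂) * (v * z))
    ≡ (t₁ + (y₁ * v * (w + 2 * z) + y₁ * z * u + x₁ * (v * z))) + (t₂ + (y₂ * v * (w + 2 * z) + y₂ * z * u + x₂ * (v * z)))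
  ring₁ = solve-∀
  ring₂ : ∀ x₁ x₂ u w → x₁ * u * w + x₂ * u * w ≡ (x₁ + x₂) * u * w
  ring₂ = solve-∀

-- Coefficients of forests and their closed form

#_[_] : Colour → Colour → ℕ
# x [ y ] = if x == y then 1 else 0

-- The coefficient of aⁱ bʲ cᵏ in the product of the series X, Y, Z listed in `es`. The first tree
-- is a leaf and is dropped, or it is a node: then `forests₊` uses up one vertex of its colour and
-- puts its two children in front.
forests : List Colour → ℕ → ℕ → ℕ → ℕ
forests₊ : Colour → List Colour → ℕ → ℕ → ℕ → ℕ
forests []       zero zero zero = 1
forests []       _    _    _    = 0
forests (m ∷ es) i    j    k    = forests es i j k + forests₊ m es i j k
forests₊ a es (suc i) j       k       = forests (b ∷ c ∷ es) i j k
forests₊ b es i       (suc j) k       = forests (c ∷ a ∷ es) i j k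
forests₊ c es i       j       (suc k) = forests (a ∷ b ∷ es) i j k
forests₊ _ _  _       _       _       = 0

occ : Colour → List Colour → ℕ
occ x []       = 0
occ x (y ∷ es) = # x [ y ] + occ x es

+-suc₃ : ∀ x y z → x + (y + suc z) ≡ suc (x + (y + z))
+-suc₃ x y z = trans (cong (x +_) (+-suc y z)) (+-suc x (y + z))

-- Multiplying by `p * q * r` lets absorption replace each `D` by a binomial coefficient, which
-- makes the correction a polynomial multiple of the main term.
absorb-correction : ∀ p i q j r k → p * q * r * correction (p C i) (D p i) (q C j) (D q j) (r C k) (D r k)
  ≡ (i * j * r + i * k * q + j * k * p + 2 * (i * j * k)) * ((p C i) * (q C j) * (r C k))
absorb-correction p i q j r k = begin
  p * q * r * correction c₁ d₁ c₂ d₂ c₃ d₃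
    ≡⟨ ring₁ p q r c₁ d₁ c₂ d₂ c₃ d₃ ⟩
  (p * d₁) * (q * d₂) * (r * c₃ + 2 * (r * d₃)) + (p * d₁) * (r * d₃) * (q * c₂) + (p * c₁) * ((q * d₂) * (r * d₃))
    ≡⟨ cong₃ (λ x y z → x * y * (r * c₃ + 2 * z) + x * z * (q * c₂) + (p * c₁) * (y * z))
         (sym (absorb p i)) (sym (absorb q j)) (sym (absorb r k)) ⟩
  (i * c₁) * (j * c₂) * (r * c₃ + 2 * (k * c₃)) + (i * c₁) * (k * c₃) * (q * c₂) + (p * c₁) * ((j * c₂) * (k * c₃))
    ≡⟨ ring₂ p q r i j k c₁ c₂ c₃ ⟩
  (i * j * r + i * k * q + j * k * p + 2 * (i * j * k)) * (c₁ * c₂ * c₃) ∎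
  where
  open ≡-Reasoning
  c₁ = p C i
  c₂ = q C j
  c₃ = r C k
  d₁ = D p i
  d₂ = D q j
  d₃ = D r k
  cong₃ : ∀ (f : ℕ → ℕ → ℕ → ℕ) {x x′ y y′ z z′} → x ≡ x′ → y ≡ y′ → z ≡ z′ → f x y z ≡ f x′ y′ z′
  cong₃ f refl refl refl = refl
  ring₁ : ∀ p q r c₁ d₁ c₂ d₂ c₃ d₃ →
    p * q * r * ((d₁ * d₂) * (c₃ + 2 * d₃) + (d₁ * d₃) * c₂ + c₁ * (d₂ * d₃))
    ≡ (p * d₁) * (q * d₂) * (r * c₃ + 2 * (r * d₃)) + (p * d₁) * (r * d₃) * (q * c₂) + (p * c₁) * ((q * d₂) * (r * d₃))
  ring₁ = solve-∀
  ring₂ : ∀ p q r i j k c₁ c₂ c₃ →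
    (i * c₁) * (j * c₂) * (r * c₃ + 2 * (k * c₃)) + (i * c₁) * (k * c₃) * (q * c₂) + (p * c₁) * ((j * c₂) * (k * c₃))
    ≡ (i * j * r + i * k * q + j * k * p + 2 * (i * j * k)) * (c₁ * c₂ * c₃)
  ring₂ = solve-∀

-- For the empty forest the factor from `absorb-correction` is exactly (j + k)(i + k)(i + j), so
-- main term and correction cancel, as they must for the constant series 1.
closed-root : ∀ i j k .{{_ : NonZero (j + k)}} .{{_ : NonZero (i + k)}} .{{_ : NonZero (i + j)}} →
  Closed 0 (j + k) i (i + k) j (i + j) k
closed-root i j k = closedBy (*-cancelˡ-≡ _ _ _ {{m*n≢0 (p * q) r {{m*n≢0 p q}}}}
  (trans (absorb-correction p i q j r k) (cong (_* ((p C i) * (q C j) * (r C k))) (ring i j k))))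
  where
  p = j + k
  q = i + k
  r = i + j
  ring : ∀ i j k → i * j * (i + j) + i * k * (i + k) + j * k * (j + k) + 2 * (i * j * k)
    ≡ (j + k) * (i + k) * (i + j)
  ring = solve-∀

-- When two of the three degrees vanish, one of the exponents is 0 and cannot be cancelled; instead
-- the binomial coefficient itself is 0.
closed-axis : ∀ i q r → Closed 0 0 (suc i) q 0 r 0
closed-axis i q r rewrite k>n⇒nCk≡0 {0} {suc i} (s≤s z≤n) = closedBy refl

closed-[] : ∀ i j k → Closed (forests [] i j k) (j + k) i (i + k) j (i + j) k
closed-[] zero    zero    zero    = closedBy refl
closed-[] (suc i) zero    zero    = closed-axis i _ _
closed-[] zero    (suc j) zero    = swap₁₂ 0 (suc j) _ 0 _ 0 (closed-axis j _ _)
closed-[] zero    zero    (suc k) = swap₁₃ 0 (suc k) _ 0 _ 0 (closed-axis k _ _)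
closed-[] (suc i) (suc j) k       = closed-root (suc i) (suc j) k
closed-[] (suc i) zero    (suc k) = closed-root (suc i) zero (suc k)
closed-[] zero    (suc j) (suc k) = closed-root zero (suc j) (suc k)

-- Dropping a head `a` lowers `p` by one. Replacing it by `b`, `c` while lowering `i` also lowers
-- `p` by one and keeps `q` and `r`, as the new occurrences offset the smaller `i`. These are the
-- two terms of Pascal's rule; `b` and `c` are alike.
closed : ∀ es i j k {p q r} → p ≡ occ a es + (j + k) → q ≡ occ b es + (i + k) → r ≡ occ c es + (i + j) →
  Closed (forests es i j k) p i q j r k
closed [] i j k refl refl refl = closed-[] i j k
closed (a ∷ es) zero j k {suc p} {q} {r} refl e₂ e₃ =
  subst (λ t → Closed t (suc p) 0 q j r k) (sym (+-identityʳ _)) (closed-zero p q j r k (closed es zero j k refl e₂ e₃))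
closed (a ∷ es) (suc i) j k {suc p} {q} {r} refl e₂ e₃ =
  closed-suc p i q j r k
    (λ z → m+n≡0⇒m≡0 j (m+n≡0⇒n≡0 (occ a es) z))
    (λ z → m+n≡0⇒n≡0 j (m+n≡0⇒n≡0 (occ a es) z))
    (closed es (suc i) j k refl e₂ e₃)
    (closed (b ∷ c ∷ es) i j k refl (trans e₂ (+-suc (occ b es) (i + k))) (trans e₃ (+-suc (occ c es) (i + j))))
closed (b ∷ es) i zero k {p} {suc q} {r} e₁ refl e₃ =
  subst (λ t → Closed t p i (suc q) 0 r k) (sym (+-identityʳ _))
    (swap₁₂ (suc q) 0 p i r k (closed-zero q p i r k (swap₁₂ p i q 0 r k (closed es i zero k e₁ refl e₃))))
closed (b ∷ es) i (suc j) k {p} {suc q} {r} e₁ refl e₃ =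
  swap₁₂ (suc q) (suc j) p i r k (closed-suc q j p i r k
    (λ z → m+n≡0⇒m≡0 i (m+n≡0⇒n≡0 (occ b es) z))
    (λ z → m+n≡0⇒n≡0 i (m+n≡0⇒n≡0 (occ b es) z))
    (swap₁₂ p i q (suc j) r k (closed es i (suc j) k e₁ refl e₃))
    (swap₁₂ p i q j r k (closed (c ∷ a ∷ es) i j k (trans e₁ (+-suc (occ a es) (j + k))) refl (trans e₃ (+-suc₃ (occ c es) i j)))))
closed (c ∷ es) i j zero {p} {q} {suc r} e₁ e₂ refl =
  subst (λ t → Closed t p i q j (suc r) 0) (sym (+-identityʳ _))
    (swap₁₃ (suc r) 0 q j p i (closed-zero r q j p i (swap₁₃ p i q j r 0 (closed es i j zero e₁ e₂ refl))))
closed (c ∷ es) i j (suc k) {p} {q} {suc r} e₁ e₂ refl =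
  swap₁₃ (suc r) (suc k) q j p i (closed-suc r k q j p i
    (λ z → m+n≡0⇒n≡0 i (m+n≡0⇒n≡0 (occ c es) z))
    (λ z → m+n≡0⇒m≡0 i (m+n≡0⇒n≡0 (occ c es) z))
    (swap₁₃ p i q j r (suc k) (closed es i j (suc k) e₁ e₂ refl))
    (swap₁₃ p i q j r k (closed (a ∷ b ∷ es) i j k (trans e₁ (+-suc₃ (occ a es) j k)) (trans e₂ (+-suc₃ (occ b es) i k)) refl)))

-- A single tree missing `a` has p = 1 + j + k, q = i + k, r = i + j. What remains of p q r after
-- removing the correction factor is i (i + j + k), the numerator of the formula.
formula-suc : ∀ i j k → Formula (suc i) (suc j) (suc k) (forests (a ∷ []) (suc i) j k)
formula-suc i′ j k = +-cancelʳ-≡ (x * ccc) _ _ (begin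
  t * (p * q * r) + x * ccc    ≡⟨ cong (_+ x * ccc) (*-comm t (p * q * r)) ⟩
  p * q * r * t + x * ccc      ≡⟨ cong (p * q * r * t +_) (absorb-correction p i q j r k) ⟨
  p * q * r * t + p * q * r * e ≡⟨ *-distribˡ-+ (p * q * r) t e ⟨
  p * q * r * (t + e)           ≡⟨ cong (p * q * r *_) (Closed.formula (closed (a ∷ []) i j k refl refl refl)) ⟩
  p * q * r * ccc               ≡⟨ ring i j k (p C i) (q C j) (r C k) ⟩
  i * (i + j + k) * (p C i) * (q C j) * (r C k) + x * ccc ∎)
  where
  open ≡-Reasoning
  i = suc i′
  t = forests (a ∷ []) i j k
  p = suc (j + k)
  q = i + k
  r = i + j
  x = i * j * r + i * k * q + j * k * p + 2 * (i * j * k)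
  ccc = (p C i) * (q C j) * (r C k)
  e = correction (p C i) (D p i) (q C j) (D q j) (r C k) (D r k)
  ring : ∀ i j k c₁ c₂ c₃ → suc (j + k) * (i + k) * (i + j) * (c₁ * c₂ * c₃)
    ≡ i * (i + j + k) * c₁ * c₂ * c₃
      + (i * j * (i + j) + i * k * (i + k) + j * k * suc (j + k) + 2 * (i * j * k)) * (c₁ * c₂ * c₃)
  ring = solve-∀

-- Binary trees with cyclic colours, and their enumeration

nx : Colour → Colour
nx a = b
nx b = c
nx c = a

-- The index is the colour missing on the base edge.
data Tree : Colour → Set where
  leaf : ∀ {m} → Tree m
  node : ∀ {m} → Tree (nx m) → Tree (nx (nx m)) → Tree m

-- Each inner vertex is the apex of exactly one node, and the apex of a node missing `m` has colour
-- `m`; counting nodes by colour thus counts inner vertices.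
weight : ∀ {m} → Colour → Tree m → ℕ
weight x leaf             = 0
weight x (node {m} t₁ t₂) = # x [ m ] + (weight x t₁ + weight x t₂)

Forest : List Colour → Set
Forest = All Tree

weights : ∀ {es} → Colour → Forest es → ℕ
weights x []      = 0
weights x (t ∷ f) = weight x t + weights x f

record Weighs (w : Colour → ℕ) (i j k : ℕ) : Set where
  constructor weighs
  field
    is-a : w a ≡ i
    is-b : w b ≡ j
    is-c : w c ≡ k

Weighs-irrelevant : ∀ {w i j k} (p q : Weighs w i j k) → p ≡ q
Weighs-irrelevant (weighs refl refl refl) (weighs refl refl refl) = refl

WForest : List Colour → (i j k : ℕ) → Set
WForest es i j k = Σ (Forest es) λ f → Weighs (λ x → weights x f) i j k

WForest₊ : Colour → List Colour → (i j k : ℕ) → Set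
WForest₊ m es i j k = Σ (Forest (nx m ∷ nx (nx m) ∷ es)) λ f → Weighs (λ x → # x [ m ] + weights x f) i j k

Σ-≡ : ∀ {A : Set} {w : A → Colour → ℕ} {i j k} {x y : Σ A λ z → Weighs (w z) i j k} → proj₁ x ≡ proj₁ y → x ≡ y
Σ-≡ {x = x , p} {.x , q} refl = cong (x ,_) (Weighs-irrelevant p q)

Weighs-cong : ∀ {w w′ i j k} → (∀ x → w x ≡ w′ x) → Weighs w i j k → Weighs w′ i j k
Weighs-cong e (weighs p q r) = weighs (trans (sym (e a)) p) (trans (sym (e b)) q) (trans (sym (e c)) r)

node-weights : ∀ {m es} (t₁ : Tree (nx m)) (t₂ : Tree (nx (nx m))) (f : Forest es) x →
  weights x (node t₁ t₂ ∷ f) ≡ # x [ m ] + weights x (t₁ ∷ t₂ ∷ f)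
node-weights {m} t₁ t₂ f x = trans (+-assoc (# x [ m ]) _ (weights x f))
  (cong (# x [ m ] +_) (+-assoc (weight x t₁) (weight x t₂) (weights x f)))

-- The bijective form of the recursion for `forests`: the first tree is a leaf or a node.
step : ∀ m es i j k → (WForest es i j k ⊎ WForest₊ m es i j k) ↔ WForest (m ∷ es) i j k
step m es i j k = mk↔ₛ′ to from to-from from-to
  where
  to : WForest es i j k ⊎ WForest₊ m es i j k → WForest (m ∷ es) i j k
  to (inj₁ (f , w))             = leaf ∷ f , w
  to (inj₂ ((t₁ ∷ t₂ ∷ f) , w)) = node t₁ t₂ ∷ f , Weighs-cong (λ x → sym (node-weights t₁ t₂ f x)) w
  from : WForest (m ∷ es) i j k → WForest es i j k ⊎ WForest₊ m es i j k
  from (leaf ∷ f , w)       = inj₁ (f , w)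
  from (node t₁ t₂ ∷ f , w) = inj₂ ((t₁ ∷ t₂ ∷ f) , Weighs-cong (node-weights t₁ t₂ f) w)
  to-from : ∀ y → to (from y) ≡ y
  to-from (leaf ∷ f , w)       = refl
  to-from (node t₁ t₂ ∷ f , w) = Σ-≡ refl
  from-to : ∀ y → from (to y) ≡ y
  from-to (inj₁ (f , w))             = refl
  from-to (inj₂ ((t₁ ∷ t₂ ∷ f) , w)) = cong inj₂ (Σ-≡ refl)

⊥-↔ : {A : Set} → (A → ⊥) → Fin 0 ↔ A
⊥-↔ h = mk↔ₛ′ (λ ()) (λ x → ⊥-elim (h x)) (λ x → ⊥-elim (h x)) (λ ())

Weighs-map : ∀ {A : Set} {w w′ : A → Colour → ℕ} {i j k i′ j′ k′} →
  (∀ {z} → Weighs (w z) i j k → Weighs (w′ z) i′ j′ k′) → (∀ {z} → Weighs (w′ z) i′ j′ k′ → Weighs (w z) i j k) →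
  (Σ A λ z → Weighs (w z) i j k) ↔ (Σ A λ z → Weighs (w′ z) i′ j′ k′)
Weighs-map f g = mk↔ₛ′ (λ (z , p) → z , f p) (λ (z , p) → z , g p) (λ _ → Σ-≡ refl) (λ _ → Σ-≡ refl)

enumerate : ∀ es i j k → Fin (forests es i j k) ↔ WForest es i j k
enumerate₊ : ∀ m es i j k → Fin (forests₊ m es i j k) ↔ WForest₊ m es i j k
enumerate [] zero zero zero = mk↔ₛ′ (λ _ → [] , weighs refl refl refl) (λ _ → zero)
  (λ { ([] , weighs refl refl refl) → refl }) (λ { zero → refl })
enumerate [] zero zero (suc k) = ⊥-↔ λ { ([] , weighs _ _ ()) }
enumerate [] zero (suc j) k = ⊥-↔ λ { ([] , weighs _ () _) }
enumerate [] (suc i) j k = ⊥-↔ λ { ([] , weighs () _ _) }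
enumerate (m ∷ es) i j k = (+↔⊎ ⟫ (enumerate es i j k ⊎-↔ enumerate₊ m es i j k)) ⟫ step m es i j k
  where
  _⟫_ : {A B C : Set} → A ↔ B → B ↔ C → A ↔ C
  f ⟫ g = g ↔-∘ f
enumerate₊ a es (suc i) j k = Weighs-map (λ (weighs p q r) → weighs (cong suc p) q r) (λ (weighs p q r) → weighs (suc-injective p) q r)
  ↔-∘ enumerate (b ∷ c ∷ es) i j k
enumerate₊ a es zero j k = ⊥-↔ λ { (_ , weighs () _ _) }
enumerate₊ b es i (suc j) k = Weighs-map (λ (weighs p q r) → weighs p (cong suc q) r) (λ (weighs p q r) → weighs p (suc-injective q) r)
  ↔-∘ enumerate (c ∷ a ∷ es) i j k
enumerate₊ b es i zero k = ⊥-↔ λ { (_ , weighs _ () _) }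
enumerate₊ c es i j (suc k) = Weighs-map (λ (weighs p q r) → weighs p q (cong suc r)) (λ (weighs p q r) → weighs p q (suc-injective r))
  ↔-∘ enumerate (a ∷ b ∷ es) i j k
enumerate₊ c es i j zero = ⊥-↔ λ { (_ , weighs _ _ ()) }

WTree : Colour → (i j k : ℕ) → Set
WTree m i j k = Σ (Tree m) λ t → Weighs (λ x → weight x t) i j k

single : ∀ m i j k → WForest (m ∷ []) i j k ↔ WTree m i j k
single m i j k = mk↔ₛ′
  (λ { (t ∷ [] , w) → t , Weighs-cong (λ x → +-identityʳ (weight x t)) w })
  (λ (t , w) → t ∷ [] , Weighs-cong (λ x → sym (+-identityʳ (weight x t))) w)
  (λ _ → Σ-≡ refl) (λ { (t ∷ [] , w) → Σ-≡ refl })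

-- Triangulations as binary trees

-- The endpoint colours of an edge missing m, for the two possible orientations.
start end : Bool → Colour → Colour
start true  m = nx m
start false m = nx (nx m)
end true  m = nx (nx m)
end false m = nx m

-- The left edge joins the start to the apex and so misses the end colour; the right edge misses the
-- start colour.
leftMissing rightMissing : Bool → Colour → Colour
leftMissing  true  m = nx (nx m)
leftMissing  false m = nx m
rightMissing true  m = nx m
rightMissing false m = nx (nx m)

Base : Bool → Colour → Colour → Colour → Set
Base o m x y = x ≡ start o m × y ≡ end o m

left-base : ∀ o m → Base (not o) (leftMissing o m) (start o m) m
left-base true  a = refl , refl
left-base true  b = refl , refl
left-base true  c = refl , refl
left-base false a = refl , refl
left-base false b = refl , refl
left-base false c = refl , refl

right-base : ∀ o m → Base (not o) (rightMissing o m) m (end o m)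
right-base true  a = refl , refl
right-base true  b = refl , refl
right-base true  c = refl , refl
right-base false a = refl , refl
right-base false b = refl , refl
right-base false c = refl , refl

apex-rainbow : ∀ o m → Rainbow (start o m) m (end o m)
apex-rainbow true  a = tt
apex-rainbow true  b = tt
apex-rainbow true  c = tt
apex-rainbow false a = tt
apex-rainbow false b = tt
apex-rainbow false c = tt

rainbow-apex : ∀ o m x → Rainbow (start o m) x (end o m) → x ≡ m
rainbow-apex true  a a _ = refl
rainbow-apex true  b b _ = refl
rainbow-apex true  c c _ = refl
rainbow-apex false a a _ = refl
rainbow-apex false b b _ = refl
rainbow-apex false c c _ = refl

-- Passing to a child edge reverses the orientation o of the base colouring, so
-- mirroring every other level makes the colours of the subtrees independent of o.
toTree : ∀ (o : Bool) m {i j} → Tri i j → Tree m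
toTree o     m (edge _)        = leaf
toTree true  m (split _ _ l r) = node (toTree false (nx m) r) (toTree false (nx (nx m)) l)
toTree false m (split _ _ l r) = node (toTree true (nx m) l) (toTree true (nx (nx m)) r)

Tri⇒< : ∀ {i j} → Tri i j → i < j
Tri⇒< (edge i)            = n<1+n i
Tri⇒< (split i<k k<j _ _) = <-trans i<k k<j

glue : ∀ {i} (x : Σ ℕ (Tri i)) → Σ ℕ (Tri (proj₁ x)) → Σ ℕ (Tri i)
glue (k , l) (j , r) = j , split (Tri⇒< l) (Tri⇒< r) l r

-- The end vertex depends on the shape of the tree, so it is returned along with the triangulation;
-- the right part begins where the left part ends.
fromTree : ∀ (o : Bool) {m} i → Tree m → Σ ℕ (Tri i)
fromTree o     i leaf         = suc i , edge i
fromTree true  i (node t₁ t₂) = glue (fromTree false i t₂) (fromTree false _ t₁)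
fromTree false i (node t₁ t₂) = glue (fromTree true i t₁) (fromTree true _ t₂)

toTree-fromTree : ∀ (o : Bool) {m} i (t : Tree m) → toTree o m (proj₂ (fromTree o i t)) ≡ t
toTree-fromTree o     i leaf         = refl
toTree-fromTree true  i (node t₁ t₂) = cong₂ node (toTree-fromTree false _ t₁) (toTree-fromTree false i t₂)
toTree-fromTree false i (node t₁ t₂) = cong₂ node (toTree-fromTree true i t₁) (toTree-fromTree true _ t₂)

-- `F` leaves the starting vertex of the right part open, so the left equation can be matched first
-- and the right one is then well typed.
glue-≡ : ∀ {i k j} {l : Tri i k} {r : Tri k j} {x} (F : ∀ k → Σ ℕ (Tri k)) (i<k : i < k) (k<j : k < j) →
  x ≡ (k , l) → F k ≡ (j , r) → glue x (F (proj₁ x)) ≡ (j , split i<k k<j l r)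
glue-≡ {l = l} {r} F i<k k<j refl e rewrite e =
  cong₂ (λ p q → _ , split p q l r) (<-irrelevant _ _) (<-irrelevant _ _)

fromTree-toTree : ∀ (o : Bool) m {i j} (τ : Tri i j) → fromTree o i (toTree o m τ) ≡ (j , τ)
fromTree-toTree o     m (edge i)            = refl
fromTree-toTree true  m (split i<k k<j l r) =
  glue-≡ (λ k → fromTree false k (toTree false (nx m) r)) i<k k<j (fromTree-toTree false _ l) (fromTree-toTree false _ r)
fromTree-toTree false m (split i<k k<j l r) =
  glue-≡ (λ k → fromTree true k (toTree true (nx (nx m)) r)) i<k k<j (fromTree-toTree true _ l) (fromTree-toTree true _ r)

size : ∀ {m} → Tree m → ℕ
size t = weight a t + weight b t + weight c t

size-node : ∀ {m} (t₁ : Tree (nx m)) (t₂ : Tree (nx (nx m))) → size (node {m} t₁ t₂) ≡ suc (size t₁ + size t₂)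
size-node {m} t₁ t₂ = go m (weight a t₁) (weight b t₁) (weight c t₁) (weight a t₂) (weight b t₂) (weight c t₂)
  where
  ring-a : ∀ x y z x′ y′ z′ → 1 + (x + x′) + (y + y′) + (z + z′) ≡ suc (x + y + z + (x′ + y′ + z′))
  ring-a = solve-∀
  ring-b : ∀ x y z x′ y′ z′ → (x + x′) + (1 + (y + y′)) + (z + z′) ≡ suc (x + y + z + (x′ + y′ + z′))
  ring-b = solve-∀
  ring-c : ∀ x y z x′ y′ z′ → (x + x′) + (y + y′) + (1 + (z + z′)) ≡ suc (x + y + z + (x′ + y′ + z′))
  ring-c = solve-∀
  go : ∀ m x y z x′ y′ z′ → # a [ m ] + (x + x′) + (# b [ m ] + (y + y′)) + (# c [ m ] + (z + z′))
    ≡ suc (x + y + z + (x′ + y′ + z′))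
  go a = ring-a
  go b = ring-b
  go c = ring-c

fromTree-end : ∀ o {m} i (t : Tree m) → proj₁ (fromTree o i t) ≡ suc (size t + i)
fromTree-end o     i leaf         = refl
fromTree-end true  i (node t₁ t₂) rewrite size-node t₁ t₂ =
  trans (fromTree-end false _ t₁) (cong suc (trans (cong (size t₁ +_) (fromTree-end false i t₂))
    (trans (+-suc (size t₁) _) (cong suc (sym (+-assoc (size t₁) (size t₂) i))))))
fromTree-end false i (node t₁ t₂) rewrite size-node t₁ t₂ =
  trans (fromTree-end true _ t₂) (cong suc (trans (cong (size t₂ +_) (fromTree-end true i t₁))
    (ring (size t₁) (size t₂) i)))
  where
  ring : ∀ x y z → y + suc (x + z) ≡ suc (x + y + z)
  ring = solve-∀

weight-split : ∀ x o m {i k j} (i<k : i < k) (k<j : k < j) l r → weight x (toTree o m (split i<k k<j l r))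
  ≡ # x [ m ] + (weight x (toTree (not o) (leftMissing o m) l) + weight x (toTree (not o) (rightMissing o m) r))
weight-split x true  m _ _ l r = cong (# x [ m ] +_) (+-comm (weight x (toTree false (nx m) r)) _)
weight-split x false m _ _ l r = refl

-- Colourings of triangulations: vertex counts, uniqueness, existence

RainbowAt : (ℕ → Colour) → ℕ × ℕ × ℕ → Set
RainbowAt f (x , y , z) = Rainbow (f x) (f y) (f z)

-- A colouring is a function on all of ℕ, so it restricts to sub-polygons without reindexing.
Colours : ∀ {i j} → (ℕ → Colour) → Bool → Colour → Tri i j → Set
Colours {i} {j} f o m τ = Base o m (f i) (f j) × All (RainbowAt f) (triangles τ)

colours-split : ∀ f o m {i k j} (i<k : i < k) (k<j : k < j) l r → Colours f o m (split i<k k<j l r) →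
  f k ≡ m × Colours f (not o) (leftMissing o m) l × Colours f (not o) (rightMissing o m) r
colours-split f o m {i} {k} {j} _ _ l r ((fi , fj) , apex ∷ rest) = fk ,
  ((trans fi (proj₁ (left-base o m)) , trans fk (proj₂ (left-base o m))) , proj₁ (++⁻ (triangles l) rest)) ,
  ((trans fk (proj₁ (right-base o m)) , trans fj (proj₂ (right-base o m))) , proj₂ (++⁻ (triangles l) rest))
  where
  fk : f k ≡ m
  fk = rainbow-apex o m (f k) (subst₂ (λ x y → Rainbow x (f k) y) fi fj apex)

-- The number of y < n with f y = x.
cum : (ℕ → Colour) → Colour → ℕ → ℕ
cum f x zero    = 0
cum f x (suc n) = cum f x n + # x [ f n ]

-- The difference of the two `cum` values counts the vertices strictly between `i` and `j`. In a
-- split, the apex is the last vertex counted by `cum f x (suc k)`.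
cum-tri : ∀ f o m {i j} (τ : Tri i j) → Colours f o m τ → ∀ x →
  cum f x j ≡ cum f x (suc i) + weight x (toTree o m τ)
cum-tri f o m (edge i) _ x = sym (+-identityʳ _)
cum-tri f o m {i} {j} (split {k = k} i<k k<j l r) h x with colours-split f o m i<k k<j l r h
... | fk , hl , hr = begin
  cum f x j                                   ≡⟨ cum-tri f (not o) (rightMissing o m) r hr x ⟩
  cum f x k + # x [ f k ] + wr                ≡⟨ cong₂ (λ u v → u + # x [ v ] + wr) (cum-tri f (not o) (leftMissing o m) l hl x) fk ⟩
  cum f x (suc i) + wl + # x [ m ] + wr       ≡⟨ ring (cum f x (suc i)) wl (# x [ m ]) wr ⟩
  cum f x (suc i) + (# x [ m ] + (wl + wr))   ≡⟨ cong (cum f x (suc i) +_) (weight-split x o m i<k k<j l r) ⟨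
  cum f x (suc i) + weight x (toTree o m (split i<k k<j l r)) ∎
  where
  open ≡-Reasoning
  wl = weight x (toTree (not o) (leftMissing o m) l)
  wr = weight x (toTree (not o) (rightMissing o m) r)
  ring : ∀ u v w z → u + v + w + z ≡ u + (w + (v + z))
  ring = solve-∀

colours-unique : ∀ f g o m {i j} (τ : Tri i j) → Colours f o m τ → Colours g o m τ → ∀ x → i ≤ x → x ≤ j → f x ≡ g x
colours-unique f g o m (edge i) ((fi , fj) , _) ((gi , gj) , _) x i≤x x≤j with m≤n⇒m<n∨m≡n x≤j
... | inj₂ refl = trans fj (sym gj)
... | inj₁ x<j with ≤-antisym i≤x (≤-pred x<j)
...   | refl = trans fi (sym gi)
colours-unique f g o m (split {k = k} i<k k<j l r) hf hg x i≤x x≤j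
  with colours-split f o m i<k k<j l r hf | colours-split g o m i<k k<j l r hg | ≤-total x k
... | _ , fl , _ | _ , gl , _ | inj₁ x≤k = colours-unique f g (not o) (leftMissing o m) l fl gl x i≤x x≤k
... | _ , _ , fr | _ , _ , gr | inj₂ k≤x = colours-unique f g (not o) (rightMissing o m) r fr gr x k≤x x≤j

rainbow-cong : ∀ {f g i j} (τ : Tri i j) → (∀ x → i ≤ x → x ≤ j → f x ≡ g x) →
  All (RainbowAt f) (triangles τ) → All (RainbowAt g) (triangles τ)
rainbow-cong (edge _) e h = []
rainbow-cong {f} {g} {i} {j} (split {k = k} i<k k<j l r) e (p ∷ h) =
  cong₃ (e i ≤-refl (<⇒≤ (<-trans i<k k<j))) (e k (<⇒≤ i<k) (<⇒≤ k<j)) (e j (<⇒≤ (<-trans i<k k<j)) ≤-refl) p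
  ∷ ++⁺ (rainbow-cong l (λ x i≤x x≤k → e x i≤x (≤-trans x≤k (<⇒≤ k<j))) (proj₁ (++⁻ (triangles l) h)))
        (rainbow-cong r (λ x k≤x x≤j → e x (≤-trans (<⇒≤ i<k) k≤x) x≤j) (proj₂ (++⁻ (triangles l) h)))
  where
  cong₃ : ∀ {x y z x′ y′ z′} → x ≡ x′ → y ≡ y′ → z ≡ z′ → Rainbow x y z → Rainbow x′ y′ z′
  cong₃ refl refl refl p = p

paste : ℕ → (f g : ℕ → Colour) → ℕ → Colour
paste k f g x with x ≤? k
... | yes _ = f x
... | no _  = g x

paste-≤ : ∀ {k} f g x → x ≤ k → paste k f g x ≡ f x
paste-≤ {k} f g x x≤k with x ≤? k
... | yes _  = refl
... | no x≰k = contradiction x≤k x≰k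

paste-≥ : ∀ {k} f g → f k ≡ g k → ∀ x → k ≤ x → paste k f g x ≡ g x
paste-≥ {k} f g e x k≤x with x ≤? k
... | no _    = refl
... | yes x≤k with ≤-antisym k≤x x≤k
...   | refl = e

-- The colourings of the two parts both give the apex colour `m`, so they can be pasted there.
colouring : ∀ o m {i j} (τ : Tri i j) → ∃ λ f → Colours f o m τ
colouring o m (edge i) = paste i (λ _ → start o m) (λ _ → end o m) ,
  (paste-≤ {i} _ _ i ≤-refl , at-end) , []
  where
  at-end : paste i (λ _ → start o m) (λ _ → end o m) (suc i) ≡ end o m
  at-end with suc i ≤? i
  ... | no _  = refl
  ... | yes p = contradiction p (n≮n i)
colouring o m {i} {j} (split {k = k} i<k k<j l r)
  with colouring (not o) (leftMissing o m) l | colouring (not o) (rightMissing o m) r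
... | f , (fi , fk) , hl | g , (gk , gj) , hr = h , (hi , hj) ,
  subst₂ (λ x y → Rainbow x (h k) y) (sym hi) (sym hj) (subst (λ x → Rainbow (start o m) x (end o m)) (sym hk) (apex-rainbow o m))
  ∷ ++⁺ (rainbow-cong l (λ x _ x≤k → sym (paste-≤ f g x x≤k)) hl)
        (rainbow-cong r (λ x k≤x _ → sym (paste-≥ f g f≡g x k≤x)) hr)
  where
  h : ℕ → Colour
  h = paste k f g
  f≡m : f k ≡ m
  f≡m = trans fk (sym (proj₂ (left-base o m)))
  f≡g : f k ≡ g k
  f≡g = trans f≡m (trans (proj₁ (right-base o m)) (sym gk))
  hi : h i ≡ start o m
  hi = trans (paste-≤ f g i (<⇒≤ i<k)) (trans fi (sym (proj₁ (left-base o m))))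
  hk : h k ≡ m
  hk = trans (paste-≤ f g k ≤-refl) f≡m
  hj : h j ≡ end o m
  hj = trans (paste-≥ f g f≡g j (<⇒≤ k<j)) (trans gj (sym (proj₂ (right-base o m))))

-- Colour vectors and proper colourings

tabulate : ∀ n → (ℕ → Colour) → Vec Colour n
tabulate zero    f = []
tabulate (suc n) f = f 0 ∷ tabulate n (f ∘ suc)

col-tabulate : ∀ n f x → x < n → col (tabulate n f) x ≡ f x
col-tabulate (suc n) f zero    _         = refl
col-tabulate (suc n) f (suc x) (s≤s x<n) = col-tabulate n (f ∘ suc) x x<n

col-injective : ∀ {n} (v w : Vec Colour n) → (∀ x → x < n → col v x ≡ col w x) → v ≡ w
col-injective []      []      _ = refl
col-injective (x ∷ v) (y ∷ w) e = cong₂ _∷_ (e 0 z<s) (col-injective v w (λ k k<n → e (suc k) (s≤s k<n)))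

cum-suc : ∀ f x n → cum f x (suc n) ≡ # x [ f 0 ] + cum (f ∘ suc) x n
cum-suc f x zero    = sym (+-identityʳ _)
cum-suc f x (suc n) = trans (cong (_+ # x [ f (suc n) ]) (cum-suc f x n)) (+-assoc (# x [ f 0 ]) _ _)

count-∷ : ∀ x y {n} (v : Vec Colour n) → count x (y ∷ v) ≡ # x [ y ] + count x v
count-∷ x y v with x == y
... | true  = refl
... | false = refl

count-cum : ∀ x {n} (v : Vec Colour n) → count x v ≡ cum (col v) x n
count-cum x []      = refl
count-cum x {suc n} (y ∷ v) = trans (count-∷ x y v)
  (trans (cong (# x [ y ] +_) (count-cum x v)) (sym (cum-suc (col (y ∷ v)) x n)))

-- The root edge runs from `b` = `nx a` to `c` = `nx (nx a)`: it misses `a`, with orientation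
-- `true`.
proper⇒colours : ∀ {n} τ v → Proper n τ v → Colours (col v) true a τ
proper⇒colours τ v (p , q , h) = (p , q) , h

count-proper : ∀ {n} τ v → Proper n τ v → ∀ x → count x v ≡ # x [ b ] + weight x (toTree true a τ) + # x [ c ]
count-proper {n} τ v p@(p₀ , p₁ , _) x = begin
  count x v                                       ≡⟨ count-cum x v ⟩
  cum (col v) x (suc n) + # x [ col v (suc n) ]   ≡⟨ cong₂ (λ u y → u + # x [ y ]) (cum-tri (col v) true a τ (proper⇒colours τ v p) x) p₁ ⟩
  # x [ col v 0 ] + weight x (toTree true a τ) + # x [ c ] ≡⟨ cong (λ y → # x [ y ] + weight x (toTree true a τ) + # x [ c ]) p₀ ⟩
  # x [ b ] + weight x (toTree true a τ) + # x [ c ] ∎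
  where open ≡-Reasoning

proper-unique : ∀ {n} τ v w → Proper n τ v → Proper n τ w → v ≡ w
proper-unique τ v w p q = col-injective v w (λ x x<n →
  colours-unique (col v) (col w) true a τ (proper⇒colours τ v p) (proper⇒colours τ w q) x z≤n (≤-pred x<n))

proper-exists : ∀ n τ → ∃ (Proper n τ)
proper-exists n τ with colouring true a τ
... | f , (f0 , fn) , h = v , trans (col-f 0 z≤n) f0 , trans (col-f (suc n) ≤-refl) fn ,
  rainbow-cong τ (λ x _ x≤n → sym (col-f x x≤n)) h
  where
  v = tabulate (suc (suc n)) f
  col-f : ∀ x → x ≤ suc n → col v x ≡ f x
  col-f x x≤n = col-tabulate (suc (suc n)) f x (s≤s x≤n)

-- The triangulation determines its colouring, and all remaining components are proof-irrelevant.
coloured-≡ : ∀ {n α β γ} {x y : Coloured n α β γ} → proj₁ x ≡ proj₁ y → x ≡ y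
coloured-≡ {x = τ , v , p@(p₀ , p₁ , h) , p-a , p-b , p-c} {.τ , w , q@(q₀ , q₁ , h′) , q-a , q-b , q-c} refl
  with refl ← proper-unique τ v w p q
  rewrite uip p₀ q₀ | uip p₁ q₁ | All.irrelevant T-irrelevant h h′ | uip p-a q-a | uip p-b q-b | uip p-c q-c = refl

-- Assembling the bijection and the formula

coloured↔tree : ∀ n α β γ → α + suc β + suc γ ≡ n + 2 → Coloured n α (suc β) (suc γ) ↔ WTree a α β γ
coloured↔tree n α β γ total = mk↔ₛ′ to from to-from from-to
  where
  to : Coloured n α (suc β) (suc γ) → WTree a α β γ
  to (τ , v , p , p-a , p-b , p-c) = toTree true a τ , weighs
    (trans (sym (trans (count-proper τ v p a) (+-identityʳ _))) p-a)
    (suc-injective (trans (sym (trans (count-proper τ v p b) (+-identityʳ _))) p-b))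
    (suc-injective (trans (sym (trans (count-proper τ v p c) (+-comm _ 1))) p-c))
  ends : ((t , _) : WTree a α β γ) → proj₁ (fromTree true 0 t) ≡ suc n
  ends (t , weighs refl refl refl) = trans (fromTree-end true 0 t)
    -- The 2 stands for the ends of the root edge, one `b` and one `c`, which tree weights omit.
    (cong suc (+-cancelʳ-≡ 2 _ _ (trans (ring (weight a t) (weight b t) (weight c t)) total)))
    where
    ring : ∀ x y z → x + y + z + 0 + 2 ≡ x + suc y + suc z
    ring = solve-∀
  tri : WTree a α β γ → Tri 0 (suc n)
  tri x = subst (Tri 0) (ends x) (proj₂ (fromTree true 0 (proj₁ x)))
  toTree-subst : ∀ {j} (x : Σ ℕ (Tri 0)) (e : proj₁ x ≡ j) → toTree true a (subst (Tri 0) e (proj₂ x)) ≡ toTree true a (proj₂ x)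
  toTree-subst _ refl = refl
  subst-≡ : ∀ {j} {τ : Tri 0 j} {x} → x ≡ (j , τ) → (e : proj₁ x ≡ j) → subst (Tri 0) e (proj₂ x) ≡ τ
  subst-≡ refl refl = refl
  toTree-tri : ∀ x → toTree true a (tri x) ≡ proj₁ x
  toTree-tri x = trans (toTree-subst (fromTree true 0 (proj₁ x)) (ends x)) (toTree-fromTree true 0 (proj₁ x))
  from : WTree a α β γ → Coloured n α (suc β) (suc γ)
  from x@(t , weighs w-a w-b w-c) with proper-exists n (tri x)
  ... | v , p = tri x , v , p ,
    trans (counts a) (trans (+-identityʳ _) w-a) ,
    trans (counts b) (trans (+-identityʳ _) (cong suc w-b)) ,
    trans (counts c) (trans (+-comm _ 1) (cong suc w-c))
    where
    counts : ∀ y → count y v ≡ # y [ b ] + weight y t + # y [ c ]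
    counts y = trans (count-proper (tri x) v p y) (cong (λ s → # y [ b ] + weight y s + # y [ c ]) (toTree-tri x))
  to-from : ∀ x → to (from x) ≡ x
  to-from x = Σ-≡ (toTree-tri x)
  from-to : ∀ x → from (to x) ≡ x
  from-to x@(τ , _) = coloured-≡ (subst-≡ (fromTree-toTree true a τ) (ends (to x)))

no-b : ∀ {n α γ} → Coloured n α 0 γ → ⊥
no-b (τ , v , p , _ , p-b , _) = 1+n≢0 (trans (sym (count-proper τ v p b)) p-b)

no-c : ∀ {n α β} → Coloured n α β 0 → ⊥
no-c (τ , v , p , _ , _ , p-c) = 1+n≢0 (trans (+-comm 1 _) (trans (sym (count-proper τ v p c)) p-c))

-- With no vertex of colour `a` the root edge carries no triangle, so only the leaf counts; this is
-- the limit case of the formula.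
formula-root : ∀ i j k → Formula i (suc j) (suc k) (forests (a ∷ []) i j k)
formula-root zero    zero    zero    = refl
formula-root zero    zero    (suc k) = refl
formula-root zero    (suc j) k       = refl
formula-root (suc i) j       k       = formula-suc i j k

theorem1 : (n α β γ : ℕ) → α + β + γ ≡ n + 2 →
    Σ ℕ (λ N → (Fin N ↔ Coloured n α β γ) × Formula α β γ N)
-- The cases with β = 0 or γ = 0 are split as finely as the clauses of `Formula` require for it to
-- reduce.
theorem1 n zero    zero    γ       _ = 0 , ⊥-↔ no-b , refl
theorem1 n (suc α) zero    γ       _ = 0 , ⊥-↔ no-b , refl
theorem1 n zero    (suc zero) zero _ = 0 , ⊥-↔ no-c , refl
theorem1 n zero    (suc (suc β)) zero _ = 0 , ⊥-↔ no-c , refl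
theorem1 n (suc α) (suc β) zero    _ = 0 , ⊥-↔ no-c , refl
theorem1 n α (suc β) (suc γ) total = forests (a ∷ []) α β γ ,
  ↔-sym (coloured↔tree n α β γ total) ↔-∘ (single a α β γ ↔-∘ enumerate (a ∷ []) α β γ) , formula-root α β γ
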